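{- Let $m,n$ be integers with $1\leq m\leq n-1$. Let $\pi$ be a prime parking function chosen uniformly at random from the set of all prime parking functions of length $n$, and let $C_m(\pi)$ be the number of $m$-cycles of $\pi$. Then the expected number of $m$-cycles is $$\mathbb{E}_n(C_m(\pi))=(m-1)!\,\binom{n-1}{m}\Big/(n-1)^{m}.$$
   Context: A parking function of length $n$ is a sequence $\pi=(\pi_1,\dots,\pi_n)$ of positive integers such that, if $\lambda_1\le\cdots\le\lambda_n$ is the weakly increasing rearrangement of $\pi_1,\dots,\pi_n$, then $\lambda_i\le i$ for all $1\le i\le n$. A parking function $\pi$ of length $n$ is prime if for all $1\le j\le n-1$ one has $\#\{i: \pi_i\le j\}\ge j+1$. For $m\ge 1$, distinct indices $(i_1,\dots,i_m)$ in $\{1,\dots,n\}$ form an $m$-cycle of $\pi$ if $\pi_{i_1}=i_2,\ \pi_{i_2}=i_3,\dots,\pi_{i_{m-1}}=i_m,\ \pi_{i_m}=i_1$; tuples that differ by a cyclic rotation are regarded as the same $m$-cycle. For $m=1$ an $m$-cycle is a fixed point. $\mathbb{E}_n$ denotes expectation with respect to the uniform measure on the (finite) set of prime parking functions of length $n$. -}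

module Defs where

open import Data.Nat.Base using (ℕ; zero; suc; _≤_; _<_; _∸_; z≤n; s≤s; s≤s⁻¹; NonZero; >-nonZero)
open import Data.Nat.Properties
  using (_≟_; _≤?_; ≤-decTotalOrder; ≤-trans; ≤-reflexive; allUpTo?)
open import Data.Nat.ListAction using (sum)
open import Data.Nat.GeneralisedArithmetic using (iterate)
open import Data.Integer.Base using (+_)
open import Data.Rational.Base using (ℚ; _/_)
open import Data.Fin.Base using (Fin; toℕ)
open import Data.Fin.Properties using (toℕ<n) renaming (_≟_ to _≟ᶠ_; any? to anyFin?; all? to allFin?)
open import Data.List.Base as List using (List; []; _∷_; length; filter; deduplicate; allFin; upTo; cartesianProductWith)
open import Data.List.Membership.Propositional using () renaming (_∈_ to _∈ˡ_)
open import Data.List.Membership.Propositional.Properties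
  using (∈-cartesianProductWith⁺; ∈-filter⁺; ∈-filter⁻; ∈-map⁺; ∈-upTo⁺; ∈-lookup; ∈-length)
open import Data.List.Relation.Unary.Any using (here; index)
open import Data.List.Relation.Unary.Any.Properties using (lookup-index)
import Data.List.Relation.Unary.All as Allˡ
open import Data.List.Relation.Unary.Unique.Propositional using () renaming (Unique to Uniqueˡ)
import Data.List.Relation.Unary.Unique.Propositional.Properties as Uniqueˡ
import Data.List.Relation.Unary.AllPairs as AllPairsˡ
open import Data.List.Relation.Binary.Permutation.Propositional using (↭-sym)
open import Data.List.Relation.Binary.Permutation.Propositional.Properties using (∈-resp-↭; ↭-length)
open import Data.List.Sort ≤-decTotalOrder using (sort; sort-↭)
open import Data.Vec.Base as Vec using (Vec; []; _∷_; _∷ʳ_; lookup; count; replicate; toList)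
open import Data.Vec.Properties using (≡-dec; ∷-injective; length-toList)
open import Data.Vec.Relation.Unary.All as All using (All; []; _∷_)
import Data.Vec.Relation.Unary.All.Properties as Allₚ
open import Data.Vec.Relation.Unary.AllPairs using (allPairs?)
open import Data.Vec.Relation.Unary.Unique.Propositional using (Unique)
open import Data.Product.Base using (∃-syntax; _×_; _,_; proj₁; proj₂)
open import Function.Base using (_∘_)
open import Function.Bundles using (_⇔_; mk⇔; module Equivalence)
open import Relation.Nullary.Decidable using (Dec; map′; _×-dec_; _→-dec_; ¬?)
open import Relation.Binary.PropositionalEquality using (_≡_; refl; sym; trans; subst)

-- Entries are one-based while `Fin` indices are zero-based, so the
-- bound at the position `i : Fin n` is `suc (toℕ i)`.

ParkingFunction : ∀ {n} → Vec ℕ n → Set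
ParkingFunction π =
  All (1 ≤_) π ×
  (∀ i → List.lookup (sort (toList π)) i ≤ suc (toℕ i))

PrimeParkingFunction : ∀ {n} → Vec ℕ n → Set
PrimeParkingFunction {n} π =
  ParkingFunction π ×
  (∀ j → 1 ≤ j → j ≤ n ∸ 1 → suc j ≤ count (_≤? j) π)

parkingFunction? : ∀ {n} (π : Vec ℕ n) → Dec (ParkingFunction π)
parkingFunction? π =
  All.all? (1 ≤?_) π ×-dec
  allFin? (λ i → List.lookup (sort (toList π)) i ≤? suc (toℕ i))

primeParkingFunction? : ∀ {n} (π : Vec ℕ n) → Dec (PrimeParkingFunction π)
primeParkingFunction? {n} π =
  parkingFunction? π ×-dec
  map′ (λ h j 1≤j j≤n-1 → h (s≤s j≤n-1) 1≤j)
       (λ h {j} j<n 1≤j → h j 1≤j (s≤s⁻¹ j<n))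
       (allUpTo? P? (suc (n ∸ 1)))
  where
  P? : ∀ j → Dec (1 ≤ j → suc j ≤ count (_≤? j) π)
  P? j = (1 ≤? j) →-dec (suc j ≤? count (_≤? j) π)

tuples : ∀ {A : Set} → List A → ∀ k → List (Vec A k)
tuples xs zero    = [] ∷ []
tuples xs (suc k) = cartesianProductWith _∷_ xs (tuples xs k)

∈-tuples : ∀ {A : Set} {xs : List A} {k} {v : Vec A k} →
           All (_∈ˡ xs) v → v ∈ˡ tuples xs k
∈-tuples []         = here refl
∈-tuples (px ∷ pxs) = ∈-cartesianProductWith⁺ _∷_ px (∈-tuples pxs)

tuples-unique : ∀ {A : Set} {xs : List A} → Uniqueˡ xs → ∀ k → Uniqueˡ (tuples xs k)
tuples-unique u zero    = Allˡ.[] AllPairsˡ.∷ AllPairsˡ.[]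
tuples-unique u (suc k) = Uniqueˡ.cartesianProductWith⁺ _∷_ ∷-injective u (tuples-unique u k)

-- The entries of a parking function of length n lie in {1,…,n}, so it
-- suffices to search there; `∈-primeParkingFunctions` and
-- `primeParkingFunctions-unique` show that every prime parking function
-- of length n is listed exactly once.

primeParkingFunctions : ∀ n → List (Vec ℕ n)
primeParkingFunctions n = filter primeParkingFunction? (tuples (List.map suc (upTo n)) n)

private
  sort-length : ∀ {n} (π : Vec ℕ n) → length (sort (toList π)) ≡ n
  sort-length π = trans (↭-length (sort-↭ (toList π))) (length-toList π)

  entry≤n : ∀ {n} {π : Vec ℕ n} → ParkingFunction π →
            ∀ {x} → x ∈ˡ toList π → x ≤ n
  entry≤n {n} {π} (_ , bound) {x} x∈π =
    ≤-trans (subst (_≤ suc (toℕ i)) (sym (lookup-index x∈sort)) (bound i))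
            (subst (toℕ i <_) (sort-length π) (toℕ<n i))
    where
    x∈sort = ∈-resp-↭ (↭-sym (sort-↭ (toList π))) x∈π
    i      = index x∈sort

  range : ∀ {n x} → 1 ≤ x → x ≤ n → x ∈ˡ List.map suc (upTo n)
  range (s≤s z≤n) x≤n = ∈-map⁺ suc (∈-upTo⁺ x≤n)

  entries∈ : ∀ {n} {π : Vec ℕ n} → ParkingFunction π → All (_∈ˡ List.map suc (upTo n)) π
  entries∈ {π = π} p = Allₚ.toList⁻ (Allˡ.tabulate λ x∈π →
    range (Allˡ.lookup (Allₚ.toList⁺ (proj₁ p)) x∈π) (entry≤n {π = π} p x∈π))

∈-primeParkingFunctions : ∀ {n} {π : Vec ℕ n} →
                          (π ∈ˡ primeParkingFunctions n) ⇔ PrimeParkingFunction π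
∈-primeParkingFunctions {n} = mk⇔
  (λ π∈ → proj₂ (∈-filter⁻ primeParkingFunction? {xs = tuples _ n} π∈))
  (λ p  → ∈-filter⁺ primeParkingFunction? (∈-tuples (entries∈ (proj₁ p))) p)

primeParkingFunctions-unique : ∀ n → Uniqueˡ (primeParkingFunctions n)
primeParkingFunctions-unique n =
  Uniqueˡ.filter⁺ primeParkingFunction?
    (tuples-unique (Uniqueˡ.map⁺ (λ { refl → refl }) (Uniqueˡ.upTo⁺ n)) n)

private
  ones : ∀ n → Vec ℕ n
  ones n = replicate n 1

  all-ones : ∀ n → All (_≡ 1) (ones n)
  all-ones zero    = []
  all-ones (suc n) = refl ∷ all-ones n

  count-ones : ∀ n {j} → 1 ≤ j → count (_≤? j) (ones n) ≡ n
  count-ones zero    _               = refl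
  count-ones (suc n) (s≤s {n = j} z≤n) rewrite count-ones n {suc j} (s≤s z≤n) = refl

  <-of-≤∸1 : ∀ n {j} → 1 ≤ j → j ≤ n ∸ 1 → suc j ≤ n
  <-of-≤∸1 zero    (s≤s _) ()
  <-of-≤∸1 (suc n) _       j≤n = s≤s j≤n

  ones-prime : ∀ n → PrimeParkingFunction (ones n)
  ones-prime n =
    ( All.map (λ { refl → s≤s z≤n }) (all-ones n)
    , λ i → ≤-trans (≤-reflexive (entry i)) (s≤s z≤n) )
    , λ j 1≤j j≤n-1 → subst (_ ≤_) (sym (count-ones n 1≤j)) (<-of-≤∸1 n 1≤j j≤n-1)
    where
    entry : ∀ i → List.lookup (sort (toList (ones n))) i ≡ 1
    entry i = Allˡ.lookup (Allₚ.toList⁺ (all-ones n))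
                (∈-resp-↭ (sort-↭ (toList (ones n))) (∈-lookup i))

primeParkingFunctions-nonEmpty : ∀ n → NonZero (length (primeParkingFunctions n))
primeParkingFunctions-nonEmpty n =
  >-nonZero (∈-length (Equivalence.from ∈-primeParkingFunctions (ones-prime n)))

𝔼 : ∀ n → (Vec ℕ n → ℕ) → ℚ
𝔼 n X = + sum (List.map X (primeParkingFunctions n)) / length (primeParkingFunctions n)
  where instance _ = primeParkingFunctions-nonEmpty n

rotate : ∀ {A : Set} {m} → Vec A m → Vec A m
rotate []       = []
rotate (x ∷ xs) = xs ∷ʳ x

-- As vectors, (π_{i₁},…,π_{iₘ}) = (i₂,…,iₘ,i₁), the zero-based indices
-- on the right being shifted to one-based values.

IsCycle : ∀ {m n} → Vec ℕ n → Vec (Fin n) m → Set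
IsCycle π is = Unique is × Vec.map (lookup π) is ≡ Vec.map (suc ∘ toℕ) (rotate is)

isCycle? : ∀ {m n} (π : Vec ℕ n) (is : Vec (Fin n) m) → Dec (IsCycle π is)
isCycle? π is =
  allPairs? (λ i j → ¬? (i ≟ᶠ j)) is ×-dec
  ≡-dec _≟_ (Vec.map (lookup π) is) (Vec.map (suc ∘ toℕ) (rotate is))

-- For m ≥ 1 every rotation of an m-tuple is one by 0,…,m-1 places, so
-- this is an equivalence relation.

_≈ʳ_ : ∀ {m n} → Vec (Fin n) m → Vec (Fin n) m → Set
_≈ʳ_ {m} is js = ∃[ k ] iterate rotate is (toℕ {m} k) ≡ js

_≈ʳ?_ : ∀ {m n} (is js : Vec (Fin n) m) → Dec (is ≈ʳ js)
is ≈ʳ? js = anyFin? λ k → ≡-dec _≟ᶠ_ (iterate rotate is (toℕ k)) js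

-- `deduplicate` keeps exactly one tuple from each rotation class, so
-- this counts cycles rather than tuples.

cycleCount : ∀ m {n} → Vec ℕ n → ℕ
cycleCount m {n} π = length (deduplicate _≈ʳ?_ (filter (isCycle? π) (tuples (allFin n) m)))

{-# OPTIONS --safe #-}

-- Put N = n − 1 and read words of length n over {1,…,N} modulo N.  By the cycle lemma
-- every word has exactly one translate that is a prime parking function, so translation
-- invariant properties have the same probability for prime parking functions as for
-- uniform words.  The condition of being an m-cycle is not translation invariant, but
-- prime parking functions are exchangeable: moving i₁,…,iₘ to m fixed positions turns
-- the pairs of a prime parking function and a tuple representing an m-cycle into the
-- prime parking functions with distinct values at these positions.  Hence m E(Cₘ) is
-- the probability N(N−1)⋯(N−m+1) / Nᵐ that m letters of a word are distinct.
module Submission where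

open import Defs
open import Data.Nat using (ℕ; _≤_; _∸_; _*_; _^_; _!; >-nonZero)
open import Data.Nat.Properties using (≤-trans; m^n≢0)
open import Data.Nat.Combinatorics using (_C_)
open import Data.Integer using (+_)
open import Data.Rational using (_/_)
open import Relation.Binary.PropositionalEquality using (_≡_)

open import Algebra.Properties.CommutativeMonoid.Sum Data.Nat.Properties.+-0-commutativeMonoid
  using (sum-permute; sum-cong-≗) renaming (sum to ∑)
open import Algebra.Properties.CommutativeSemigroup Data.Nat.Properties.+-commutativeSemigroup
  using () renaming (interchange to +-interchange)
open import Data.Bool.Base using (if_then_else_; true; false)
open import Data.Fin.Base as Fin using (Fin; toℕ; fromℕ<; _↑ˡ_)
open import Data.Fin.Permutation
  using (Permutation′; _⟨$⟩ʳ_; _⟨$⟩ˡ_; _∘ₚ_; transpose; flip; inverseˡ) renaming (id to idₚ)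
import Data.Fin.Permutation.Components as PC
open import Data.Fin.Properties
  using (toℕ<n; toℕ-fromℕ<; toℕ-injective; ↑ˡ-injective) renaming (_≟_ to _≟ᶠ_)
import Data.Integer.Properties as ℤ
open import Data.List.Base as List
  using (List; []; _∷_; _++_; length; filter; deduplicate; allFin; upTo; cartesianProductWith)
open import Data.List.Membership.DecPropositional Data.Nat.Properties._≟_ using (_∈?_)
open import Data.List.Membership.Propositional using (_∈_)
open import Data.List.Membership.Propositional.Properties
  using (∈-map⁺; ∈-map⁻; ∈-++⁺ˡ; ∈-++⁺ʳ; ∈-++⁻; ∈-filter⁺; ∈-filter⁻; ∈-allFin; ∈-upTo⁺; ∈-upTo⁻;
         ∈-lookup; ∈-cartesianProductWith⁻)
open import Data.List.Membership.Propositional.Properties.WithK using (unique∧set⇒bag)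
open import Data.List.Properties
  using (length-++; length-map; length-tabulate; length-upTo; filter-all; filter-none; map-cong;
         ++-assoc; ++-identityʳ; ∷-injective; ∷-injectiveˡ)
open import Data.List.Relation.Binary.BagAndSetEquality using (∼bag⇒↭)
open import Data.List.Relation.Binary.Permutation.Propositional.Properties
  using (∈-resp-↭; ↭-length; filter-↭)
open import Data.List.Relation.Unary.All as All using ([]; _∷_)
import Data.List.Relation.Unary.All.Properties as Allₚ
open import Data.List.Relation.Unary.AllPairs as AllPairs using (AllPairs; []; _∷_)
import Data.List.Relation.Unary.AllPairs.Properties as AllPairsₚ
open import Data.List.Relation.Unary.Any using (here; there)
open import Data.List.Relation.Unary.Linked.Properties using (Linked⇒AllPairs)
import Data.List.Relation.Unary.Unique.Propositional as Listᵁ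
import Data.List.Relation.Unary.Unique.Propositional.Properties as Listᵁₚ
open import Data.List.Sort Data.Nat.Properties.≤-decTotalOrder using (sort; sort-↭; sort-↗)
open import Data.Nat.Base using (zero; suc; _+_; _<_; z≤n; s≤s; s≤s⁻¹; NonZero)
open import Data.Nat.Combinatorics using (nCk≡nPk/k!; nPk≡n!/[n∸k]!)
open import Data.Nat.Combinatorics.Base using (_P′_)
open import Data.Nat.Combinatorics.Specification using (k!∣nP′k; nP′k≡n!/[n∸k]!)
open import Data.Nat.DivMod as ℕ using (_%_; m≡m%n+[m/n]*n; m%n<n; m/n*n≡m; /-congˡ)
open import Data.Nat.GeneralisedArithmetic using (iterate)
open import Data.Nat.ListAction using (sum)
open import Data.Nat.Properties hiding (≤-trans; m^n≢0)
open import Data.Nat.Solver using (module +-*-Solver)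
open import Data.Product.Base using (∃-syntax; _×_; _,_; proj₁; proj₂)
open import Data.Rational.Properties using (fromℚᵘ-cong)
import Data.Rational.Unnormalised.Base as ℚᵘ
open import Data.Sum.Base using (inj₁; inj₂)
open import Data.Vec.Base as Vec using (Vec; []; _∷_; _∷ʳ_; lookup; count; toList; tabulate)
import Data.Vec.Properties as Vec
open import Data.Vec.Properties
  using (count≤n; length-toList; toList-injective; toList-∷ʳ; map-∷ʳ; cast-is-id; lookup-map;
         lookup∘tabulate; tabulate∘lookup; tabulate-cong; tabulate-∘; map-∘; map-id; ++-injective; lookup-++ˡ)
open import Data.Vec.Relation.Unary.All as Allᵛ using (All; []; _∷_)
import Data.Vec.Relation.Unary.All.Properties as Allᵛₚ
open import Data.Vec.Relation.Unary.AllPairs using (allPairs?)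
open import Data.Vec.Relation.Unary.Unique.Propositional as Vecᵁ using (Unique)
import Data.Vec.Relation.Unary.Unique.Propositional.Properties as Vecᵁₚ
open import Function.Base using (_∘_; id; _∋_)
open import Function.Bundles using (Equivalence; mk⇔)
open import Level using (0ℓ)
open import Relation.Binary.Core using (Rel)
open import Relation.Binary.Definitions
  using (Reflexive; Symmetric; Transitive; tri<; tri≈; tri>) renaming (Decidable to Decidable₂)
open import Relation.Binary.PropositionalEquality hiding ([_])
open import Relation.Nullary using (¬_; Dec; does; yes; no; contradiction)
open import Relation.Nullary.Decidable using (dec-true; dec-false; ¬?)
open import Relation.Unary using (Decidable)

-- Why exactly one translate of a word is prime: let T j be the number of letters at most j. Once
-- the word is translated back by k, the prime conditions say that T j - j exceeds its value at k
-- for k < j ≤ N and, past the turn from N to 1, that it is at least that value for j ≤ k. A word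
-- has one letter more than the alphabet, so T N - N = 1 while T 0 = 0. This gain of one per turn
-- weakens the strict inequality to a weak one past the turn, and it keeps the minimum away from N.
-- Hence k must be the last minimum of T j - j, and it lies in {0,...,N - 1}.
--
-- Replacing cycles by distinct values loses nothing because the values of a prime parking function
-- of length N + 1 are at most N and so are themselves positions: distinct values found at the fixed
-- positions can always be read as i₂,...,iₘ,i₁.
--
-- Probabilities are replaced by lengths of lists until the last step, and every difference and
-- quotient is cleared by adding or multiplying.

private variable
  A B D : Set
  m n N : ℕ

-- Counting by bijections between lists without repetitions.

map-unique : {xs : List A} (f : A → B) →
             (∀ {x y} → x ∈ xs → y ∈ xs → f x ≡ f y → x ≡ y) →
             Listᵁ.Unique xs → Listᵁ.Unique (List.map f xs)
map-unique f inj []       = []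
map-unique f inj (x∉ ∷ u) =
  Allₚ.map⁺ (All.tabulate λ y∈ eq → All.lookup x∉ y∈ (inj (here refl) (there y∈) eq))
  ∷ map-unique f (λ p q → inj (there p) (there q)) u

-- Lists without repetitions that have the same elements are permutations of each other. The double
-- counts below all rest on this.
length-bijection : {xs : List A} {ys : List B} → Listᵁ.Unique xs → Listᵁ.Unique ys → (f : A → B) →
                   (∀ {x} → x ∈ xs → f x ∈ ys) →
                   (∀ {x y} → x ∈ xs → y ∈ xs → f x ≡ f y → x ≡ y) →
                   (∀ {y} → y ∈ ys → ∃[ x ] x ∈ xs × f x ≡ y) →
                   length xs ≡ length ys
length-bijection {xs = xs} {ys} xs! ys! f into inj onto =
  trans (sym (length-map f xs))
        (↭-length (∼bag⇒↭ (unique∧set⇒bag (map-unique f inj xs!) ys! (mk⇔ to from))))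
  where
  to : ∀ {y} → y ∈ List.map f xs → y ∈ ys
  to y∈ with _ , x∈ , refl ← ∈-map⁻ f y∈ = into x∈
  from : ∀ {y} → y ∈ ys → y ∈ List.map f xs
  from y∈ with _ , x∈ , refl ← onto y∈ = ∈-map⁺ f x∈

-- The index stays in the pair, so there are no repetitions even where the fibres `g x` overlap.
pairs : List A → (A → List B) → List (A × B)
pairs []       g = []
pairs (x ∷ xs) g = List.map (x ,_) (g x) ++ pairs xs g

module _ {g : A → List B} where

  ∈-pairs⁺ : ∀ {xs x y} → x ∈ xs → y ∈ g x → (x , y) ∈ pairs xs g
  ∈-pairs⁺ (here refl) y∈ = ∈-++⁺ˡ (∈-map⁺ _ y∈)
  ∈-pairs⁺ (there x∈)  y∈ = ∈-++⁺ʳ _ (∈-pairs⁺ x∈ y∈)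

  ∈-pairs⁻ : ∀ xs {x y} → (x , y) ∈ pairs xs g → x ∈ xs × y ∈ g x
  ∈-pairs⁻ (x ∷ xs) p∈ with ∈-++⁻ (List.map (x ,_) (g x)) p∈
  ... | inj₁ q with _ , y∈ , refl ← ∈-map⁻ _ q = here refl , y∈
  ... | inj₂ q with x∈ , y∈ ← ∈-pairs⁻ xs q = there x∈ , y∈

  pairs-unique : ∀ {xs} → Listᵁ.Unique xs → (∀ {x} → x ∈ xs → Listᵁ.Unique (g x)) → Listᵁ.Unique (pairs xs g)
  pairs-unique {[]}     _        _  = []
  pairs-unique {x ∷ xs} (x∉ ∷ u) g! =
    Listᵁₚ.++⁺ (Listᵁₚ.map⁺ (λ { refl → refl }) (g! (here refl))) (pairs-unique u (g! ∘ there)) λ (p , q) →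
      let _ , _ , eq = ∈-map⁻ (x ,_) p
      in All.lookup x∉ (proj₁ (∈-pairs⁻ xs q)) (sym (cong proj₁ eq))

  length-pairs : ∀ xs → length (pairs xs g) ≡ sum (List.map (length ∘ g) xs)
  length-pairs []       = refl
  length-pairs (x ∷ xs) = trans (length-++ (List.map (x ,_) (g x)))
    (cong₂ _+_ (length-map (x ,_) (g x)) (length-pairs xs))

  length-pairs-const : ∀ {c} xs → (∀ {x} → x ∈ xs → length (g x) ≡ c) →
                       length (pairs xs g) ≡ length xs * c
  length-pairs-const []       _  = refl
  length-pairs-const (x ∷ xs) eq = trans (length-++ (List.map (x ,_) (g x)))
    (cong₂ _+_ (trans (length-map (x ,_) (g x)) (eq (here refl))) (length-pairs-const xs (eq ∘ there)))

-- Rotations of tuples and their orbits.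

iterate-+ : ∀ (f : A → A) x a b → iterate f x (a + b) ≡ iterate f (iterate f x a) b
iterate-+ f x zero    b = refl
iterate-+ f x (suc a) b = iterate-+ f (f x) a b

-- Stated for lists, since as vectors the two concatenations have lengths that agree only up to
-- commutativity of addition.
toList-iterate-rotate : ∀ (v : Vec A m) ps qs → toList v ≡ ps ++ qs →
                        toList (iterate rotate v (length ps)) ≡ qs ++ ps
toList-iterate-rotate v []       qs eq = trans eq (sym (++-identityʳ qs))
toList-iterate-rotate (x ∷ v) (p ∷ ps) qs eq with refl , eq′ ← ∷-injective eq = trans
  (toList-iterate-rotate (v ∷ʳ x) ps (qs ++ x ∷ [])
    (trans (toList-∷ʳ x v) (trans (cong (_++ x ∷ []) eq′) (++-assoc ps qs (x ∷ [])))))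
  (++-assoc qs (x ∷ []) ps)

iterate-rotate-full : ∀ (v : Vec A m) → iterate rotate v m ≡ v
iterate-rotate-full {m = m} v = trans (sym (cast-is-id refl _)) (toList-injective refl _ _
  (subst (λ l → toList (iterate rotate v l) ≡ toList v) (length-toList v)
    (toList-iterate-rotate v (toList v) [] (sym (++-identityʳ (toList v))))))

iterate-rotate-* : ∀ (v : Vec A m) q → iterate rotate v (q * m) ≡ v
iterate-rotate-* v zero = refl
iterate-rotate-* {m = m} v (suc q) = trans (iterate-+ rotate v m (q * m))
  (trans (cong (λ w → iterate rotate w (q * m)) (iterate-rotate-full v)) (iterate-rotate-* v q))

split-at : ∀ (v : Vec A m) i → ∃[ ps ] ∃[ qs ] toList v ≡ ps ++ lookup v i ∷ qs × length ps ≡ toℕ i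
split-at (x ∷ v) Fin.zero    = [] , toList v , refl , refl
split-at (x ∷ v) (Fin.suc i) with ps , qs , eq , len ← split-at v i =
  x ∷ ps , qs , cong (x ∷_) eq , cong suc len

head-iterate-rotate : ∀ (v : Vec A m) i → ∃[ qs ] toList (iterate rotate v (toℕ i)) ≡ lookup v i ∷ qs
head-iterate-rotate v i with ps , qs , eq , len ← split-at v i =
  qs ++ ps , subst (λ l → toList (iterate rotate v l) ≡ lookup v i ∷ qs ++ ps) len
               (toList-iterate-rotate v ps _ eq)

-- On tuples of length m + 1 the (m + 1)-st power of `rotate` is the identity, so its m-th power is
-- the inverse.
rotate-injective : {v w : Vec A (suc m)} → rotate v ≡ rotate w → v ≡ w
rotate-injective {m = m} {v} {w} eq = trans (sym (iterate-rotate-full v))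
  (trans (cong (λ u → iterate rotate u m) eq) (iterate-rotate-full w))

unrotate : Vec A (suc m) → Vec A (suc m)
unrotate {m = m} v = iterate rotate v m

rotate-unrotate : ∀ (v : Vec A (suc m)) → rotate (unrotate v) ≡ v
rotate-unrotate {m = m} v = trans (sym (iterate-+ rotate v m 1))
  (trans (cong (iterate rotate v) (+-comm m 1)) (iterate-rotate-full v))

map-rotate : ∀ (f : A → B) (v : Vec A m) → Vec.map f (rotate v) ≡ rotate (Vec.map f v)
map-rotate f []      = refl
map-rotate f (x ∷ v) = map-∷ʳ f x v

unique-toList : {v : Vec A m} → Unique v → Listᵁ.Unique (toList v)
unique-toList Vecᵁ.[]       = []
unique-toList (px Vecᵁ.∷ u) = Allᵛₚ.toList⁺ px ∷ unique-toList u

toList-unique : {v : Vec A m} → Listᵁ.Unique (toList v) → Unique v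
toList-unique {v = []}    []       = Vecᵁ.[]
toList-unique {v = x ∷ v} (px ∷ u) = Allᵛₚ.toList⁻ px Vecᵁ.∷ toList-unique u

rotate-unique : {v : Vec A m} → Unique v → Unique (rotate v)
rotate-unique {v = []}    u         = u
rotate-unique {v = x ∷ v} (px Vecᵁ.∷ u) = toList-unique
  (subst Listᵁ.Unique (sym (toList-∷ʳ x v))
    (Listᵁₚ.++⁺ (unique-toList u) ([] ∷ [])
      λ { (y∈ , here refl) → All.lookup (Allᵛₚ.toList⁺ px) y∈ refl }))

iterate-preserves : ∀ {P : A → Set} {f : A → A} → (∀ {x} → P x → P (f x)) →
                    ∀ k {x} → P x → P (iterate f x k)
iterate-preserves         pres zero    p = p
iterate-preserves {P = P} pres (suc k) p = iterate-preserves {P = P} pres k (pres p)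

rotate-isCycle : ∀ {π : Vec ℕ n} {is : Vec (Fin n) m} → IsCycle π is → IsCycle π (rotate is)
rotate-isCycle {is = is} (u , eq) = rotate-unique u ,
  trans (map-rotate _ is) (trans (cong rotate eq) (sym (map-rotate _ (rotate is))))

-- The relation `_≈ʳ_` bounds the number of rotations. Reduction modulo the length removes the
-- bound, after which the equivalence laws only add and subtract numbers of rotations.
iterate⇒≈ʳ : {is js : Vec (Fin n) (suc m)} → ∀ j → iterate rotate is j ≡ js → is ≈ʳ js
iterate⇒≈ʳ {m = m} {is} {js} j eq = fromℕ< (m%n<n j (suc m)) , (begin
  iterate rotate is (toℕ (fromℕ< (m%n<n j (suc m)))) ≡⟨ cong (iterate rotate is) (toℕ-fromℕ< (m%n<n j (suc m))) ⟩
  iterate rotate is (j % suc m)                      ≡⟨ iterate-rotate-* _ (j ℕ./ suc m) ⟨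
  iterate rotate (iterate rotate is (j % suc m)) ((j ℕ./ suc m) * suc m) ≡⟨ iterate-+ rotate is (j % suc m) _ ⟨
  iterate rotate is (j % suc m + (j ℕ./ suc m) * suc m) ≡⟨ cong (iterate rotate is) (m≡m%n+[m/n]*n j (suc m)) ⟨
  iterate rotate is j                                ≡⟨ eq ⟩
  js                                                 ∎)
  where open ≡-Reasoning

≈ʳ-refl : {is : Vec (Fin n) (suc m)} → is ≈ʳ is
≈ʳ-refl = iterate⇒≈ʳ 0 refl

≈ʳ-trans : {is js ks : Vec (Fin n) (suc m)} → is ≈ʳ js → js ≈ʳ ks → is ≈ʳ ks
≈ʳ-trans {is = is} (a , refl) (b , refl) = iterate⇒≈ʳ (toℕ a + toℕ b) (iterate-+ rotate is (toℕ a) (toℕ b))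

≈ʳ-sym : {is js : Vec (Fin n) (suc m)} → is ≈ʳ js → js ≈ʳ is
≈ʳ-sym {m = m} {is = is} (a , refl) = iterate⇒≈ʳ (suc m ∸ toℕ a)
  (trans (sym (iterate-+ rotate is (toℕ a) _))
    (trans (cong (iterate rotate is) (m+[n∸m]≡n (<⇒≤ (toℕ<n a)))) (iterate-rotate-full is)))

orbit : Vec A m → List (Vec A m)
orbit {m = m} v = List.map (λ i → iterate rotate v (toℕ i)) (allFin m)

-- The rotation by i places begins with entry i, and the entries are distinct.
orbit-unique : {v : Vec A m} → Unique v → Listᵁ.Unique (orbit v)
orbit-unique {m = m} {v} u = Listᵁₚ.map⁺ inj (Listᵁₚ.allFin⁺ m)
  where
  inj : ∀ {i j} → iterate rotate v (toℕ i) ≡ iterate rotate v (toℕ j) → i ≡ j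
  inj {i} {j} eq with _ , p ← head-iterate-rotate v i | _ , q ← head-iterate-rotate v j =
    Vecᵁₚ.lookup-injective u i j (∷-injectiveˡ (trans (sym p) (trans (cong toList eq) q)))

length-orbit : ∀ (v : Vec A m) → length (orbit v) ≡ m
length-orbit {m = m} v = trans (length-map _ (allFin m)) (length-tabulate {n = m} id)

∈-orbit⁺ : {is js : Vec (Fin n) m} → is ≈ʳ js → js ∈ orbit is
∈-orbit⁺ (i , refl) = ∈-map⁺ _ (∈-allFin i)

∈-orbit⁻ : {is js : Vec (Fin n) m} → js ∈ orbit is → is ≈ʳ js
∈-orbit⁻ js∈ with i , _ , refl ← ∈-map⁻ _ js∈ = i , refl

-- Rotation classes and the number of cycles.

allPairs-representative : {R : Rel A 0ℓ} → Symmetric R →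
  ∀ {xs x y} → AllPairs (λ x y → ¬ R x y) xs → x ∈ xs → y ∈ xs → R x y → x ≡ y
allPairs-representative s (p ∷ ps) (here refl) (here refl) r = refl
allPairs-representative s (p ∷ ps) (here refl) (there y∈)  r = contradiction r (All.lookup p y∈)
allPairs-representative s (p ∷ ps) (there x∈)  (here refl) r = contradiction (s r) (All.lookup p x∈)
allPairs-representative s (p ∷ ps) (there x∈)  (there y∈)  r = allPairs-representative s ps x∈ y∈ r

module _ {R : Rel A 0ℓ} (R? : Decidable₂ R) where

  deduplicate-allPairs : ∀ xs → AllPairs (λ x y → ¬ R x y) (deduplicate R? xs)
  deduplicate-allPairs []       = []
  deduplicate-allPairs (x ∷ xs) = Allₚ.all-filter (¬? ∘ R? x) (deduplicate R? xs)
    ∷ AllPairsₚ.filter⁺ (¬? ∘ R? x) (deduplicate-allPairs xs)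

  ∈-deduplicate⁻ : ∀ xs {x} → x ∈ deduplicate R? xs → x ∈ xs
  ∈-deduplicate⁻ (x ∷ xs) (here refl) = here refl
  ∈-deduplicate⁻ (x ∷ xs) (there y∈)  =
    there (∈-deduplicate⁻ xs (proj₁ (∈-filter⁻ (¬? ∘ R? x) {xs = deduplicate R? xs} y∈)))

  deduplicate-represents : Reflexive R → Transitive R →
    ∀ {xs x} → x ∈ xs → ∃[ r ] r ∈ deduplicate R? xs × R r x
  deduplicate-represents rfl trns {x ∷ xs} (here refl) = x , here refl , rfl
  deduplicate-represents rfl trns {x ∷ xs} (there y∈)
    with r , r∈ , Rry ← deduplicate-represents rfl trns y∈ | R? x r
  -- Here x deletes r from the list and takes over as representative.
  ... | yes Rxr = x , here refl , trns Rxr Rry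
  ... | no ¬Rxr = r , there (∈-filter⁺ (¬? ∘ R? x) r∈ ¬Rxr) , Rry

∈-tuples⁻ : ∀ {xs : List A} k {v : Vec A k} → v ∈ tuples xs k → Allᵛ.All (_∈ xs) v
∈-tuples⁻ zero    {[]} _ = Allᵛ.[]
∈-tuples⁻ {xs = xs} (suc k) v∈ with _ , _ , x∈ , t∈ , refl ← ∈-cartesianProductWith⁻ _∷_ xs (tuples xs k) v∈ =
  x∈ Allᵛ.∷ ∈-tuples⁻ k t∈

cycles : ∀ m → Vec ℕ n → List (Vec (Fin n) m)
cycles {n} m π = filter (isCycle? π) (tuples (allFin n) m)

∈-cycles⁺ : ∀ {π : Vec ℕ n} {is : Vec (Fin n) m} → IsCycle π is → is ∈ cycles m π
∈-cycles⁺ {π = π} c = ∈-filter⁺ (isCycle? π) (∈-tuples (Allᵛ.universal ∈-allFin _)) c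

∈-cycles⁻ : ∀ (π : Vec ℕ n) {is : Vec (Fin n) m} → is ∈ cycles m π → IsCycle π is
∈-cycles⁻ {n} {m} π is∈ = proj₂ (∈-filter⁻ (isCycle? π) {xs = tuples (allFin n) m} is∈)

cycles-unique : ∀ m (π : Vec ℕ n) → Listᵁ.Unique (cycles m π)
cycles-unique {n} m π = Listᵁₚ.filter⁺ (isCycle? π) (tuples-unique (Listᵁₚ.allFin⁺ n) m)

-- A cycle is a rotation class of m-tuples, and since the entries of such a tuple
-- are distinct the class has exactly m elements.
cycleCount-* : ∀ m (π : Vec ℕ n) → cycleCount (suc m) π * suc m ≡ length (cycles (suc m) π)
cycleCount-* {n} m π = trans
  (sym (length-pairs-const reps λ {r} _ → length-orbit r))
  (length-bijection
    (pairs-unique reps! λ r∈ → orbit-unique (proj₁ (∈-cycles⁻ π (rep∈ r∈))))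
    (cycles-unique (suc m) π)
    proj₂ into inj onto)
  where
  cs reps : List (Vec (Fin n) (suc m))
  cs   = cycles (suc m) π
  reps = deduplicate _≈ʳ?_ cs

  rep∈ : ∀ {r} → r ∈ reps → r ∈ cs
  rep∈ = ∈-deduplicate⁻ _≈ʳ?_ cs

  representative : ∀ {r s} → r ∈ reps → s ∈ reps → r ≈ʳ s → r ≡ s
  representative = allPairs-representative {R = _≈ʳ_} ≈ʳ-sym (deduplicate-allPairs _≈ʳ?_ cs)

  reps! : Listᵁ.Unique reps
  reps! = AllPairs.map (λ { ¬r refl → ¬r ≈ʳ-refl }) (deduplicate-allPairs _≈ʳ?_ cs)

  into : ∀ {p} → p ∈ pairs reps orbit → proj₂ p ∈ cs
  into p∈ with r∈ , x∈ ← ∈-pairs⁻ reps p∈ with k , refl ← ∈-orbit⁻ x∈ =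
    ∈-cycles⁺ {π = π} (iterate-preserves {P = IsCycle π} (rotate-isCycle {π = π}) (toℕ k) (∈-cycles⁻ π (rep∈ r∈)))

  inj : ∀ {p q} → p ∈ pairs reps orbit → q ∈ pairs reps orbit → proj₂ p ≡ proj₂ q → p ≡ q
  inj {_ , x} p∈ q∈ refl with r∈ , x∈r ← ∈-pairs⁻ reps p∈ | s∈ , x∈s ← ∈-pairs⁻ reps q∈ =
    cong (_, x) (representative r∈ s∈ (≈ʳ-trans (∈-orbit⁻ x∈r) (≈ʳ-sym (∈-orbit⁻ x∈s))))

  onto : ∀ {x} → x ∈ cs → ∃[ p ] p ∈ pairs reps orbit × proj₂ p ≡ x
  onto x∈ with r , r∈ , r≈x ← deduplicate-represents _≈ʳ?_ ≈ʳ-refl ≈ʳ-trans x∈ =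
    (r , _) , ∈-pairs⁺ r∈ (∈-orbit⁺ r≈x) , refl

-- Prime parking functions described by counts alone.

indicator : {P : Set} → Dec P → ℕ
indicator P? = if does P? then 1 else 0

indicator-true : {P : Set} (P? : Dec P) → P → indicator P? ≡ 1
indicator-true P? p rewrite dec-true P? p = refl

indicator-false : {P : Set} (P? : Dec P) → ¬ P → indicator P? ≡ 0
indicator-false P? ¬p rewrite dec-false P? ¬p = refl

module _ {P : A → Set} (P? : Decidable P) where

  count-∷ : ∀ x (v : Vec A n) → count P? (x ∷ v) ≡ indicator (P? x) + count P? v
  count-∷ x v with does (P? x)
  ... | true  = refl
  ... | false = refl

  count-∑ : (v : Vec A n) → count P? v ≡ ∑ (indicator ∘ P? ∘ lookup v)
  count-∑ []      = refl
  count-∑ (x ∷ v) = trans (count-∷ x v) (cong (λ t → indicator (P? x) + t) (count-∑ v))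

  count-filter : (v : Vec A n) → count P? v ≡ length (filter P? (toList v))
  count-filter []      = refl
  count-filter (x ∷ v) with does (P? x)
  ... | true  = cong suc (count-filter v)
  ... | false = count-filter v

  count-full⇒All : (v : Vec A n) → n ≤ count P? v → All P v
  count-full⇒All [] _ = []
  count-full⇒All (x ∷ v) h with P? x
  ... | yes p = p ∷ count-full⇒All v (s≤s⁻¹ h)
  ... | no _  = contradiction h (<⇒≱ (s≤s (count≤n P? v)))

-- In a sorted list the elements of a downward closed set form an initial segment: once one entry
-- fails, all later ones fail.
sorted-lookup : ∀ {P : ℕ → Set} (P? : Decidable P) → (∀ {x y} → x ≤ y → P y → P x) →
  ∀ {xs} → AllPairs _≤_ xs → ∀ i → toℕ i < length (filter P? xs) → P (List.lookup xs i)
sorted-lookup P? ↓ {x ∷ xs} (x≤ ∷ s) i h with P? x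
sorted-lookup P? ↓ {x ∷ xs} (x≤ ∷ s) Fin.zero    h | yes p = p
sorted-lookup P? ↓ {x ∷ xs} (x≤ ∷ s) (Fin.suc i) h | yes p = sorted-lookup P? ↓ s i (s≤s⁻¹ h)
sorted-lookup P? ↓ {x ∷ xs} (x≤ ∷ s) i           h | no ¬p =
  contradiction (subst (λ ys → toℕ i < length ys) (filter-none P? (All.map (λ x≤y Py → ¬p (↓ x≤y Py)) x≤)) h) λ ()

InRange : ℕ → ℕ → Set
InRange N v = 1 ≤ v × v ≤ N

-- For length N + 1 this is primality without the sorted rearrangement, in a form visibly symmetric
-- in the positions.
PrimeCounts : ∀ N → Vec ℕ n → Set
PrimeCounts N π = All (InRange N) π × (∀ j → 1 ≤ j → j ≤ N → suc j ≤ count (_≤? j) π)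

-- The condition at j = N says that all N + 1 entries are at most N. For N = 0 there is no such
-- condition, and the prime parking function (1) has its entry outside the range.
prime⇒counts : ∀ {N} {π : Vec ℕ (suc N)} → 1 ≤ N → PrimeParkingFunction π → PrimeCounts N π
prime⇒counts {N} {π} 1≤N ((pos , _) , h) =
  Allᵛ.zip (pos , count-full⇒All (_≤? N) π (h N 1≤N ≤-refl)) , h

counts⇒prime : ∀ {N} {π : Vec ℕ (suc N)} → PrimeCounts N π → PrimeParkingFunction π
counts⇒prime {N} {π} (range , h) = (Allᵛ.map proj₁ range , bound) , h
  where
  sorted = sort (toList π)

  bound : ∀ i → List.lookup sorted i ≤ suc (toℕ i)
  bound i with suc (toℕ i) ≤? N
  -- With i zero-based, at least i + 2 entries are at most i + 1, more than the i + 1 required.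
  ... | yes i<N = sorted-lookup (_≤? suc (toℕ i)) ≤-trans (Linked⇒AllPairs ≤-trans (sort-↗ (toList π))) i
    (<⇒≤ (subst (suc (suc (toℕ i)) ≤_)
      (trans (count-filter (_≤? suc (toℕ i)) π) (sym (↭-length (filter-↭ (_≤? suc (toℕ i)) (sort-↭ (toList π))))))
      (h (suc (toℕ i)) (s≤s z≤n) i<N)))
  -- Only the last position is left, and every entry is at most N.
  ... | no i≮N = ≤-trans
    (All.lookup (Allᵛₚ.toList⁺ (Allᵛ.map proj₂ range)) (∈-resp-↭ (sort-↭ (toList π)) (∈-lookup i)))
    (≰⇒≥ i≮N)

-- Permutations of the positions.

permute : Permutation′ n → Vec A n → Vec A n
permute τ v = tabulate (lookup v ∘ (τ ⟨$⟩ʳ_))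

lookup-permute : ∀ (τ : Permutation′ n) (v : Vec A n) i → lookup (permute τ v) i ≡ lookup v (τ ⟨$⟩ʳ i)
lookup-permute τ v = lookup∘tabulate (lookup v ∘ (τ ⟨$⟩ʳ_))

permute-flip : ∀ (τ : Permutation′ n) (v : Vec A n) → permute τ (permute (flip τ) v) ≡ v
permute-flip τ v = trans
  (tabulate-cong λ i → trans (lookup-permute (flip τ) v _) (cong (lookup v) (inverseˡ τ)))
  (tabulate∘lookup v)

permute-injective : ∀ (τ : Permutation′ n) {v w : Vec A n} → permute τ v ≡ permute τ w → v ≡ w
permute-injective τ {v} {w} eq = trans (sym (permute-flip (flip τ) v))
  (trans (cong (permute (flip τ)) eq) (permute-flip (flip τ) w))

map-lookup-permute : ∀ (τ : Permutation′ n) (v : Vec A n) (is : Vec (Fin n) m) →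
  Vec.map (lookup (permute τ v)) is ≡ Vec.map (lookup v) (Vec.map (τ ⟨$⟩ʳ_) is)
map-lookup-permute τ v is = trans (Vec.map-cong (lookup-permute τ v) is) (map-∘ (lookup v) (τ ⟨$⟩ʳ_) is)

count-permute : ∀ {P : A → Set} (P? : Decidable P) (τ : Permutation′ n) v → count P? (permute τ v) ≡ count P? v
count-permute P? τ v = begin
  count P? (permute τ v)                         ≡⟨ count-∑ P? (permute τ v) ⟩
  ∑ (indicator ∘ P? ∘ lookup (permute τ v))      ≡⟨ sum-cong-≗ (cong (indicator ∘ P?) ∘ lookup-permute τ v) ⟩
  ∑ (indicator ∘ P? ∘ lookup v ∘ (τ ⟨$⟩ʳ_))      ≡⟨ sum-permute (indicator ∘ P? ∘ lookup v) τ ⟨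
  ∑ (indicator ∘ P? ∘ lookup v)                  ≡⟨ count-∑ P? v ⟨
  count P? v                                     ∎
  where open ≡-Reasoning

counts-permute : ∀ {N} (τ : Permutation′ n) {π : Vec ℕ n} → PrimeCounts N π → PrimeCounts N (permute τ π)
counts-permute {N = N} τ {π} (range , h) =
  Allᵛₚ.lookup⁻ (λ i → subst (InRange N) (sym (lookup-permute τ π i)) (Allᵛₚ.lookup⁺ range _)) ,
  λ j 1≤j j≤N → subst (suc j ≤_) (sym (count-permute (_≤? j) τ π)) (h j 1≤j j≤N)

transpose-matchˡ : ∀ (i j : Fin n) → PC.transpose i j i ≡ j
transpose-matchˡ i j rewrite dec-true (i ≟ᶠ i) refl = refl

transpose-mismatch : ∀ {i j k : Fin n} → k ≢ i → k ≢ j → PC.transpose i j k ≡ k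
transpose-mismatch {i = i} {j} {k} k≢i k≢j rewrite dec-false (k ≟ᶠ i) k≢i | dec-false (k ≟ᶠ j) k≢j = refl

-- Extends the assignment of `ys` to `xs` to a permutation of all positions: after the tails are
-- aligned, the current image of x is swapped with y.
align : Vec (Fin n) m → Vec (Fin n) m → Permutation′ n
align []       []       = idₚ
align (x ∷ xs) (y ∷ ys) = align xs ys ∘ₚ transpose (align xs ys ⟨$⟩ʳ x) y

-- The last swap leaves the aligned tail alone: y is not in `ys` by distinctness, and neither is the
-- image of x, because x is not in `xs` and a permutation is injective.
map-align : {xs ys : Vec (Fin n) m} → Unique xs → Unique ys → Vec.map (align xs ys ⟨$⟩ʳ_) xs ≡ ys
map-align {xs = []}     {[]}     _             _             = refl
map-align {xs = x ∷ xs} {y ∷ ys} (x∉ Vecᵁ.∷ u) (y∉ Vecᵁ.∷ w) =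
  cong₂ _∷_ (transpose-matchˡ z y) (trans (map-∘ (PC.transpose z y) (τ ⟨$⟩ʳ_) xs)
    (trans (cong (Vec.map (PC.transpose z y)) rest) (fixes (Allᵛ.zip (z∉ , y∉)))))
  where
  τ = align xs ys
  z = τ ⟨$⟩ʳ x
  rest = map-align u w

  z∉ : All (z ≢_) ys
  z∉ = subst (All (z ≢_)) rest (Allᵛₚ.map⁺ (Allᵛ.map
    (λ x≢ eq → x≢ (trans (sym (inverseˡ τ)) (trans (cong (τ ⟨$⟩ˡ_) eq) (inverseˡ τ)))) x∉))

  fixes : ∀ {l} {v : Vec (Fin _) l} → All (λ t → z ≢ t × y ≢ t) v → Vec.map (PC.transpose z y) v ≡ v
  fixes []              = refl
  fixes ((p , q) ∷ pqs) = cong₂ _∷_ (transpose-mismatch (p ∘ sym) (q ∘ sym)) (fixes pqs)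

lookup-injective⇒unique : {v : Vec A m} → (∀ i j → lookup v i ≡ lookup v j → i ≡ j) → Unique v
lookup-injective⇒unique {v = v} inj = subst Unique (tabulate∘lookup v) (Vecᵁₚ.tabulate⁺ (inj _ _))

unique-map-reflect : ∀ {f : A → B} {g : A → D} {v : Vec A m} →
  (∀ x y → g x ≡ g y → f x ≡ f y) → Unique (Vec.map f v) → Unique (Vec.map g v)
unique-map-reflect {f = f} {g} {v} h u = lookup-injective⇒unique λ i j eq →
  Vecᵁₚ.lookup-injective u i j (trans (lookup-map i f v) (trans
    (h _ _ (trans (sym (lookup-map i g v)) (trans eq (lookup-map j g v))))
    (sym (lookup-map j f v))))

-- Cyclic translation of words and the cycle lemma.

-- The inverse of translation by k on the residues {1,…,k+d} modulo k+d.
shift : ℕ → ℕ → ℕ → ℕ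
shift k d v = if does (v ≤? k) then v + d else v ∸ k

shift-≤ : ∀ {k d v} → v ≤ k → shift k d v ≡ v + d
shift-≤ {k} {d} {v} h rewrite dec-true (v ≤? k) h = refl

shift-> : ∀ {k d} v → shift k d (k + suc v) ≡ suc v
shift-> {k} {d} v rewrite dec-false (k + suc v ≤? k) (λ h → m+1+n≰m k h) = m+n∸m≡n k (suc v)

-- A view of {1,...,k+d} that exposes the upper block as `k + suc v`, so that the subtraction in
-- `shift` computes away.
data Position (k d : ℕ) : ℕ → Set where
  low  : ∀ v → suc v ≤ k → Position k d (suc v)
  high : ∀ v → suc v ≤ d → Position k d (k + suc v)

position : ∀ k d {v} → InRange (k + d) v → Position k d v
position k d {suc v} (1≤v , v≤) with suc v ≤? k
... | yes v≤k = low v v≤k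
... | no  v≰k with w , refl ← m≤n⇒∃[o]m+o≡n (≰⇒> v≰k) =
  subst (Position k d) (+-suc k w) (high w (+-cancelˡ-≤ k (suc w) d (≤-trans (≤-reflexive (+-suc k w)) v≤)))

shift-range : ∀ k d {v} → InRange (k + d) v → InRange (k + d) (shift k d v)
shift-range k d r with position k d r
... | low v v≤k rewrite shift-≤ {k} {d} v≤k = s≤s z≤n , +-monoˡ-≤ d v≤k
... | high w w<d rewrite shift-> {k} {d} w = s≤s z≤n , ≤-trans w<d (m≤n+m d k)

shift-inverse : ∀ k d {v} → InRange (k + d) v → shift d k (shift k d v) ≡ v
shift-inverse k d r with position k d r
... | low v v≤k =
  trans (cong (shift d k) (trans (shift-≤ {k} {d} v≤k) (+-comm (suc v) d)))
        (shift-> {d} {k} v)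
... | high w w<d =
  trans (cong (shift d k) (shift-> {k} {d} w)) (trans (shift-≤ {d} {k} w<d) (+-comm (suc w) k))

-- Since j ≤ d, entries up to k land above j, so the translated entries at most j come exactly from
-- k+1,...,k+j.
count-map-+-low : ∀ k d {j} → k + j ≤ k + d → (f : Vec ℕ n) → All (InRange (k + d)) f →
  count (_≤? j) (Vec.map (shift k d) f) + count (_≤? k) f ≡ count (_≤? (k + j)) f
count-map-+-low k d h [] [] = refl
count-map-+-low k d {j} h (v ∷ f) (r ∷ rs) = begin
  count (_≤? j) (shift k d v ∷ f′) + count (_≤? k) (v ∷ f)
    ≡⟨ cong₂ _+_ (count-∷ (_≤? j) (shift k d v) f′) (count-∷ (_≤? k) v f) ⟩
  (indicator (shift k d v ≤? j) + count (_≤? j) f′) + (indicator (v ≤? k) + count (_≤? k) f)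
    ≡⟨ +-interchange (indicator (shift k d v ≤? j)) _ _ _ ⟩
  (indicator (shift k d v ≤? j) + indicator (v ≤? k)) + (count (_≤? j) f′ + count (_≤? k) f)
    ≡⟨ cong₂ _+_ pointwise (count-map-+-low k d h f rs) ⟩
  indicator (v ≤? (k + j)) + count (_≤? (k + j)) f
    ≡⟨ count-∷ (_≤? (k + j)) v f ⟨
  count (_≤? (k + j)) (v ∷ f) ∎
  where
  open ≡-Reasoning
  f′ = Vec.map (shift k d) f
  pointwise : indicator (shift k d v ≤? j) + indicator (v ≤? k) ≡ indicator (v ≤? (k + j))
  pointwise with position k d r
  ... | low w w<k rewrite shift-≤ {k} {d} w<k = trans
    (cong₂ _+_ (indicator-false (suc w + d ≤? j) λ le → <⇒≱ (s≤s (m≤n+m d w)) (≤-trans le (+-cancelˡ-≤ k j d h)))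
               (indicator-true (suc w ≤? k) w<k))
    (sym (indicator-true (suc w ≤? (k + j)) (≤-trans w<k (m≤m+n k j))))
  ... | high w w<d rewrite shift-> {k} {d} w with suc w ≤? j
  ...   | yes p = trans (cong₂ _+_ (indicator-true (suc w ≤? j) p) (indicator-false (k + suc w ≤? k) (m+1+n≰m k)))
                        (sym (indicator-true (k + suc w ≤? k + j) (+-monoʳ-≤ k p)))
  ...   | no ¬p = trans (cong₂ _+_ (indicator-false (suc w ≤? j) ¬p) (indicator-false (k + suc w ≤? k) (m+1+n≰m k)))
                        (sym (indicator-false (k + suc w ≤? k + j) (¬p ∘ +-cancelˡ-≤ k (suc w) j)))

-- Past the turn, the translated entries at most l + d come from all entries above k together with
-- those at most l.
count-map-+-high : ∀ k d {l} → l ≤ k → (f : Vec ℕ n) → All (InRange (k + d)) f →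
  count (_≤? (l + d)) (Vec.map (shift k d) f) + count (_≤? k) f ≡ n + count (_≤? l) f
count-map-+-high k d h [] [] = refl
count-map-+-high {n = suc n} k d {l} h (v ∷ f) (r ∷ rs) = begin
  count (_≤? (l + d)) (shift k d v ∷ f′) + count (_≤? k) (v ∷ f)
    ≡⟨ cong₂ _+_ (count-∷ (_≤? (l + d)) (shift k d v) f′) (count-∷ (_≤? k) v f) ⟩
  (indicator (shift k d v ≤? (l + d)) + count (_≤? (l + d)) f′) + (indicator (v ≤? k) + count (_≤? k) f)
    ≡⟨ +-interchange (indicator (shift k d v ≤? (l + d))) _ _ _ ⟩
  (indicator (shift k d v ≤? (l + d)) + indicator (v ≤? k)) + (count (_≤? (l + d)) f′ + count (_≤? k) f)
    ≡⟨ cong₂ _+_ pointwise (count-map-+-high k d h f rs) ⟩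
  (1 + indicator (v ≤? l)) + (n + count (_≤? l) f)
    ≡⟨ +-interchange 1 (indicator (v ≤? l)) n _ ⟩
  suc n + (indicator (v ≤? l) + count (_≤? l) f)
    ≡⟨ cong (λ t → suc n + t) (count-∷ (_≤? l) v f) ⟨
  suc n + count (_≤? l) (v ∷ f) ∎
  where
  open ≡-Reasoning
  f′ = Vec.map (shift k d) f
  pointwise : indicator (shift k d v ≤? (l + d)) + indicator (v ≤? k) ≡ 1 + indicator (v ≤? l)
  pointwise with position k d r
  ... | low w w<k rewrite shift-≤ {k} {d} w<k with suc w ≤? l
  ...   | yes p = trans (cong₂ _+_ (indicator-true (suc w + d ≤? l + d) (+-monoˡ-≤ d p)) (indicator-true (suc w ≤? k) w<k))
                        (sym (cong suc (indicator-true (suc w ≤? l) p)))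
  ...   | no ¬p = trans (cong₂ _+_ (indicator-false (suc w + d ≤? l + d) (¬p ∘ +-cancelʳ-≤ d (suc w) l)) (indicator-true (suc w ≤? k) w<k))
                        (sym (cong suc (indicator-false (suc w ≤? l) ¬p)))
  pointwise | high w w<d rewrite shift-> {k} {d} w = trans
    (cong₂ _+_ (indicator-true (suc w ≤? (l + d)) (≤-trans w<d (m≤n+m d l))) (indicator-false (k + suc w ≤? k) (m+1+n≰m k)))
    (sym (cong suc (indicator-false (k + suc w ≤? l) λ le → m+1+n≰m k (≤-trans le h))))

-- k is the last point of {0,…,N} where T j ∸ j is minimal; both inequalities are
-- written without subtraction.
LastArgmin : (ℕ → ℕ) → ℕ → ℕ → Set
LastArgmin T N k = (∀ l → l ≤ k → T k + l ≤ T l + k) × (∀ j → k < j → j ≤ N → T k + j < T j + k)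

lastArgmin : ∀ T N → ∃[ k ] k ≤ N × LastArgmin T N k
lastArgmin T zero = 0 , z≤n , (λ { zero _ → ≤-refl }) , λ { (suc j) _ () }
lastArgmin T (suc N) with lastArgmin T N
... | k , k≤N , below , above with T k + suc N <? T (suc N) + k
...   | yes lt = k , m≤n⇒m≤1+n k≤N , below , above′
  where
  above′ : ∀ j → k < j → j ≤ suc N → T k + j < T j + k
  above′ j k<j j≤ with m≤n⇒m<n∨m≡n j≤
  ... | inj₁ j<  = above j k<j (s≤s⁻¹ j<)
  ... | inj₂ refl = lt
-- A tie goes to the new point, because the last minimum is wanted.
...   | no ≥ = suc N , ≤-refl , below′ , λ j N<j j≤ → contradiction (≤-trans N<j j≤) (<-irrefl refl)
  where
  minimal : ∀ l → l ≤ N → T k + l ≤ T l + k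
  minimal l l≤N with l ≤? k
  ... | yes l≤k = below l l≤k
  ... | no l≰k  = <⇒≤ (above l (≰⇒> l≰k) l≤N)

  below′ : ∀ l → l ≤ suc N → T (suc N) + l ≤ T l + suc N
  below′ l l≤ with m≤n⇒m<n∨m≡n l≤
  ... | inj₂ refl = ≤-refl
  -- Transitivity for T j - j without subtraction: the two comparisons through k are added and the
  -- common part T k + k is cancelled.
  ... | inj₁ l< = +-cancelˡ-≤ (T k + k) _ _ (begin
    T k + k + (T (suc N) + l)     ≡⟨ solve 4 (λ a b c d → a :+ b :+ (c :+ d) := (c :+ b) :+ (a :+ d)) refl (T k) k (T (suc N)) l ⟩
    (T (suc N) + k) + (T k + l)   ≤⟨ +-mono-≤ (≮⇒≥ ≥) (minimal l (s≤s⁻¹ l<)) ⟩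
    (T k + suc N) + (T l + k)     ≡⟨ solve 4 (λ a b c d → (a :+ d) :+ (c :+ b) := a :+ b :+ (c :+ d)) refl (T k) k (T l) (suc N) ⟩
    T k + k + (T l + suc N)       ∎)
    where
    open ≤-Reasoning
    open +-*-Solver

lastArgmin-unique : ∀ {T N k l} → k ≤ N → l ≤ N → LastArgmin T N k → LastArgmin T N l → k ≡ l
lastArgmin-unique {T} {N} {k} {l} k≤N l≤N (k₁ , k₂) (l₁ , l₂) with <-cmp k l
... | tri< k<l _ _ = contradiction (k₂ l k<l l≤N) (≤⇒≯ (l₁ k (<⇒≤ k<l)))
... | tri≈ _ eq _  = eq
... | tri> _ _ l<k = contradiction (l₂ k l<k k≤N) (≤⇒≯ (k₁ l (<⇒≤ l<k)))

-- The prime conditions at l + d, past the turn, give weak minimality to the left of k; those at j -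
-- k, before it, give strict minimality to the right. The assumption 1 ≤ d makes the condition at l
-- + d available also for l = 0.
shift-prime⇒lastArgmin : ∀ k d {N} → k + d ≡ N → 1 ≤ d → {f : Vec ℕ (suc N)} → All (InRange N) f →
  PrimeCounts N (Vec.map (shift k d) f) → LastArgmin (λ j → count (_≤? j) f) N k
shift-prime⇒lastArgmin k d refl 1≤d {f} range (_ , h) = below , above
  where
  T : ℕ → ℕ
  T j = count (_≤? j) f

  below : ∀ l → l ≤ k → T k + l ≤ T l + k
  below l l≤k = +-cancelˡ-≤ (suc d) _ _ (begin
    suc d + (T k + l)     ≡⟨ solve 3 (λ d t l → con 1 :+ d :+ (t :+ l) := con 1 :+ (l :+ d) :+ t) refl d (T k) l ⟩
    suc (l + d) + T k     ≤⟨ +-monoˡ-≤ (T k) (h (l + d) (≤-trans 1≤d (m≤n+m d l)) (+-monoˡ-≤ d l≤k)) ⟩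
    count (_≤? (l + d)) (Vec.map (shift k d) f) + T k ≡⟨ count-map-+-high k d l≤k f range ⟩
    suc (k + d) + T l     ≡⟨ solve 3 (λ d t k → con 1 :+ (k :+ d) :+ t := con 1 :+ d :+ (t :+ k)) refl d (T l) k ⟩
    suc d + (T l + k)     ∎)
    where
    open ≤-Reasoning
    open +-*-Solver

  above : ∀ j → k < j → j ≤ k + d → T k + j < T j + k
  above j k<j j≤ with i , refl ← m≤n⇒∃[o]m+o≡n k<j = begin
    suc (T k + (suc k + i))  ≡⟨ solve 3 (λ t k i → con 1 :+ (t :+ (con 1 :+ k :+ i)) := (con 2 :+ i) :+ t :+ k) refl (T k) k i ⟩
    suc (suc i) + T k + k    ≤⟨ +-monoˡ-≤ k (+-monoˡ-≤ (T k) (h (suc i) (s≤s z≤n) (≤-trans (s≤s (m≤n+m i k)) j≤))) ⟩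
    count (_≤? suc i) (Vec.map (shift k d) f) + T k + k
      ≡⟨ cong (_+ k) (count-map-+-low k d (≤-trans (≤-reflexive (+-suc k i)) j≤) f range) ⟩
    T (k + suc i) + k        ≡⟨ cong (λ j → T j + k) (+-suc k i) ⟩
    T (suc k + i) + k        ∎
    where
    open ≤-Reasoning
    open +-*-Solver

-- The same two counts read backwards; the cases j ≤ d and j = l + d with l ≤ k cover every j.
lastArgmin⇒shift-prime : ∀ k d {N} → k + d ≡ N → {f : Vec ℕ (suc N)} → All (InRange N) f →
  LastArgmin (λ j → count (_≤? j) f) N k → PrimeCounts N (Vec.map (shift k d) f)
lastArgmin⇒shift-prime k d refl {f} range (below , above) =
  Allᵛₚ.map⁺ (Allᵛ.map (shift-range k d) range) , counts
  where
  T : ℕ → ℕ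
  T j = count (_≤? j) f

  open ≤-Reasoning
  open +-*-Solver

  counts : ∀ j → 1 ≤ j → j ≤ k + d → suc j ≤ count (_≤? j) (Vec.map (shift k d) f)
  counts j 1≤j j≤ with j ≤? d
  ... | yes j≤d = +-cancelˡ-≤ (T k + k) _ _ (begin
    T k + k + suc j         ≡⟨ solve 3 (λ t k j → t :+ k :+ (con 1 :+ j) := con 1 :+ (t :+ (k :+ j))) refl (T k) k j ⟩
    suc (T k + (k + j))     ≤⟨ above (k + j) (≤-trans (≤-reflexive (+-comm 1 k)) (+-monoʳ-≤ k 1≤j)) (+-monoʳ-≤ k j≤d) ⟩
    T (k + j) + k           ≡⟨ cong (_+ k) (count-map-+-low k d (+-monoʳ-≤ k j≤d) f range) ⟨
    c + T k + k             ≡⟨ solve 3 (λ c t k → c :+ t :+ k := t :+ k :+ c) refl c (T k) k ⟩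
    T k + k + c             ∎)
    where c = count (_≤? j) (Vec.map (shift k d) f)
  ... | no j≰d with l , refl ← (∃[ l ] l + d ≡ j) ∋ (j ∸ d , m∸n+n≡m (≰⇒≥ j≰d)) = +-cancelʳ-≤ (T k) _ _ (begin
    suc (l + d) + T k       ≡⟨ solve 3 (λ t l d → con 1 :+ (l :+ d) :+ t := con 1 :+ d :+ (t :+ l)) refl (T k) l d ⟩
    suc d + (T k + l)       ≤⟨ +-monoʳ-≤ (suc d) (below l l≤k) ⟩
    suc d + (T l + k)       ≡⟨ solve 3 (λ t k d → con 1 :+ d :+ (t :+ k) := con 1 :+ (k :+ d) :+ t) refl (T l) k d ⟩
    suc (k + d) + T l       ≡⟨ count-map-+-high k d l≤k f range ⟨
    count (_≤? (l + d)) (Vec.map (shift k d) f) + T k ∎)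
    where
    l≤k = +-cancelʳ-≤ d l k j≤

module _ {P : A → Set} (P? : Decidable P) where

  count-all : {v : Vec A n} → All P v → count P? v ≡ n
  count-all []            = refl
  count-all {v = x ∷ v} (p ∷ ps) = trans (count-∷ P? x v) (cong₂ _+_ (indicator-true (P? x) p) (count-all ps))

  count-none : {v : Vec A n} → All (¬_ ∘ P) v → count P? v ≡ 0
  count-none []            = refl
  count-none {v = x ∷ v} (p ∷ ps) = trans (count-∷ P? x v) (cong₂ _+_ (indicator-false (P? x) p) (count-none ps))

-- The point N cannot be a minimum: all N + 1 letters are at most N and none is at most 0, so T N -
-- N = 1 exceeds T 0 - 0 = 0.
lastArgmin-count : {f : Vec ℕ (suc N)} → All (InRange N) f →
  ∃[ k ] k < N × LastArgmin (λ j → count (_≤? j) f) N k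
lastArgmin-count {N} {f} range with k , k≤N , min ← lastArgmin (λ j → count (_≤? j) f) N =
  k , ≤∧≢⇒< k≤N (λ { refl → 1+n≰n (subst₂ _≤_
    (trans (+-identityʳ _) (count-all (_≤? N) (Allᵛ.map proj₂ range)))
    (cong (_+ N) (count-none (_≤? 0) (Allᵛ.map (<⇒≱ ∘ proj₁) range)))
    (proj₁ min 0 z≤n)) }) , min

values : ℕ → List ℕ
values N = List.map suc (upTo N)

∈-values⁺ : ∀ {v} → InRange N v → v ∈ values N
∈-values⁺ {v = suc v} (_ , v≤N) = ∈-map⁺ suc (∈-upTo⁺ v≤N)

∈-values⁻ : ∀ {v} → v ∈ values N → InRange N v
∈-values⁻ v∈ with _ , i∈ , refl ← ∈-map⁻ suc v∈ = s≤s z≤n , ∈-upTo⁻ i∈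

values-unique : ∀ N → Listᵁ.Unique (values N)
values-unique N = Listᵁₚ.map⁺ suc-injective (Listᵁₚ.upTo⁺ N)

length-values : ∀ N → length (values N) ≡ N
length-values N = trans (length-map suc (upTo N)) (length-upTo N)

map-inverse : ∀ {P : A → Set} {f : A → B} {g : B → A} → (∀ {x} → P x → g (f x) ≡ x) →
  {v : Vec A n} → All P v → Vec.map g (Vec.map f v) ≡ v
map-inverse inv []       = refl
map-inverse inv (p ∷ ps) = cong₂ _∷_ (inv p) (map-inverse inv ps)

module _ (1≤N : 1 ≤ N) where

  ∈-prime⁻ : {π : Vec ℕ (suc N)} → π ∈ primeParkingFunctions (suc N) → PrimeCounts N π
  ∈-prime⁻ = prime⇒counts 1≤N ∘ Equivalence.to ∈-primeParkingFunctions

  ∈-prime⁺ : {π : Vec ℕ (suc N)} → PrimeCounts N π → π ∈ primeParkingFunctions (suc N)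
  ∈-prime⁺ = Equivalence.from ∈-primeParkingFunctions ∘ counts⇒prime

  -- The N translates of the prime parking functions are all words, each exactly once.
  length-prime-* : ∀ {Q : Vec ℕ (suc N) → Set} (Q? : Decidable Q) →
    (∀ k d {f} → k + d ≡ N → All (InRange N) f → Q f → Q (Vec.map (shift k d) f)) →
    length (filter Q? (primeParkingFunctions (suc N))) * N ≡ length (filter Q? (tuples (values N) (suc N)))
  length-prime-* {Q} Q? Q-shift = trans
    (sym (length-pairs-const ρs λ _ → length-upTo N))
    (length-bijection
      (pairs-unique (Listᵁₚ.filter⁺ Q? (primeParkingFunctions-unique (suc N))) λ _ → Listᵁₚ.upTo⁺ N)
      (Listᵁₚ.filter⁺ Q? (tuples-unique (values-unique N) (suc N)))
      unshift into inj onto)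
    where
    ρs words : List (Vec ℕ (suc N))
    ρs    = filter Q? (primeParkingFunctions (suc N))
    words = filter Q? (tuples (values N) (suc N))

    ps : List (Vec ℕ (suc N) × ℕ)
    ps = pairs ρs (λ _ → upTo N)

    -- With the arguments of `shift` in this order, this is translation by k itself, undone by
    -- `shift k (N ∸ k)`.
    unshift : Vec ℕ (suc N) × ℕ → Vec ℕ (suc N)
    unshift (π , k) = Vec.map (shift (N ∸ k) k) π

    ∈-ps⁻ : ∀ {π k} → (π , k) ∈ ps → PrimeCounts N π × Q π × k < N
    ∈-ps⁻ p∈ with π∈ , k∈ ← ∈-pairs⁻ ρs p∈ with π∈ , q ← ∈-filter⁻ Q? {xs = primeParkingFunctions (suc N)} π∈ =
      ∈-prime⁻ π∈ , q , ∈-upTo⁻ k∈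

    map-shift-range : ∀ k d {f : Vec ℕ (suc N)} → k + d ≡ N → All (InRange N) f → All (InRange N) (Vec.map (shift k d) f)
    map-shift-range k d refl = Allᵛₚ.map⁺ ∘ Allᵛ.map (shift-range k d)

    map-shift-inverse : ∀ k d {f : Vec ℕ (suc N)} → k + d ≡ N → All (InRange N) f →
      Vec.map (shift d k) (Vec.map (shift k d) f) ≡ f
    map-shift-inverse k d refl = map-inverse (shift-inverse k d)

    into : ∀ {p} → p ∈ ps → unshift p ∈ words
    into {π , k} p∈ with (range , _) , q , k<N ← ∈-ps⁻ p∈ = ∈-filter⁺ Q?
      (∈-tuples (Allᵛ.map ∈-values⁺ (map-shift-range (N ∸ k) k (m∸n+n≡m (<⇒≤ k<N)) range)))
      (Q-shift (N ∸ k) k (m∸n+n≡m (<⇒≤ k<N)) range q)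

    reshift : ∀ {π k} → (π , k) ∈ ps → Vec.map (shift k (N ∸ k)) (unshift (π , k)) ≡ π
    reshift {π} {k} p∈ with (range , _) , _ , k<N ← ∈-ps⁻ p∈ =
      map-shift-inverse (N ∸ k) k (m∸n+n≡m (<⇒≤ k<N)) range

    argmin : ∀ {π k} → (π , k) ∈ ps → LastArgmin (λ j → count (_≤? j) (unshift (π , k))) N k
    -- Translating the word back by k gives the prime π, so k is the last minimum of the word and
    -- can be recovered from it.
    argmin {π} {k} p∈ with prime@(range , _) , _ , k<N ← ∈-ps⁻ p∈ =
      shift-prime⇒lastArgmin k (N ∸ k) (m+[n∸m]≡n (<⇒≤ k<N)) (m<n⇒0<n∸m k<N)
        (map-shift-range (N ∸ k) k (m∸n+n≡m (<⇒≤ k<N)) range)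
        (subst (PrimeCounts N) (sym (reshift p∈)) prime)

    same-shift : ∀ {π k ρ l} → (π , k) ∈ ps → (ρ , l) ∈ ps → unshift (π , k) ≡ unshift (ρ , l) → k ≡ l
    same-shift {k = k} p∈ q∈ eq = lastArgmin-unique
      (<⇒≤ (proj₂ (proj₂ (∈-ps⁻ p∈)))) (<⇒≤ (proj₂ (proj₂ (∈-ps⁻ q∈))))
      (subst (λ f → LastArgmin (λ j → count (_≤? j) f) N k) eq (argmin p∈)) (argmin q∈)

    inj : ∀ {p q} → p ∈ ps → q ∈ ps → unshift p ≡ unshift q → p ≡ q
    inj {_ , k} p∈ q∈ eq with refl ← same-shift p∈ q∈ eq = cong (_, k)
      (trans (sym (reshift p∈)) (trans (cong (Vec.map (shift k (N ∸ k))) eq) (reshift q∈)))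

    onto : ∀ {f} → f ∈ words → ∃[ p ] p ∈ ps × unshift p ≡ f
    onto {f} f∈ with f∈ , q ← ∈-filter⁻ Q? {xs = tuples (values N) (suc N)} f∈
      with range ← Allᵛ.map ∈-values⁻ (∈-tuples⁻ (suc N) f∈)
      with k , k<N , min ← lastArgmin-count range =
      (Vec.map (shift k (N ∸ k)) f , k) ,
      ∈-pairs⁺ (∈-filter⁺ Q? (∈-prime⁺ (lastArgmin⇒shift-prime k (N ∸ k) k+d≡N range min))
                             (Q-shift k (N ∸ k) k+d≡N range q))
               (∈-upTo⁺ k<N) ,
      map-shift-inverse k (N ∸ k) k+d≡N range
      where
      k+d≡N = m+[n∸m]≡n (<⇒≤ k<N)

-- Words with distinct letters at given positions.

distinct? : Decidable (Unique {A = ℕ} {n = m})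
distinct? = allPairs? λ x y → ¬? (x ≟ y)

-- The fresh letters followed by the m letters of `t` list `xs` without repetition.
length-fresh : ∀ {xs} → Listᵁ.Unique xs → {t : Vec ℕ m} → Unique t → All (_∈ xs) t →
  length (filter (λ x → ¬? (x ∈? toList t)) xs) ≡ length xs ∸ m
length-fresh {m} {xs} xs! {t} t! t⊆ = begin
  length fresh           ≡⟨ m+n∸n≡m (length fresh) m ⟨
  length fresh + m ∸ m   ≡⟨ cong (λ l → length fresh + l ∸ m) (length-toList t) ⟨
  length fresh + length (toList t) ∸ m ≡⟨ cong (_∸ m) (length-++ fresh) ⟨
  length (fresh ++ toList t) ∸ m ≡⟨ cong (_∸ m) (length-bijection
    (Listᵁₚ.++⁺ (Listᵁₚ.filter⁺ _ xs!) (unique-toList t!) λ (x∈ , x∈t) → proj₂ (∈-filter⁻ _ {xs = xs} x∈) x∈t)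
    xs! id into (λ _ _ eq → eq) onto) ⟩
  length xs ∸ m          ∎
  where
  open ≡-Reasoning
  fresh = filter (λ x → ¬? (x ∈? toList t)) xs

  into : ∀ {x} → x ∈ fresh ++ toList t → x ∈ xs
  into x∈ with ∈-++⁻ fresh x∈
  ... | inj₁ x∈f = proj₁ (∈-filter⁻ _ {xs = xs} x∈f)
  ... | inj₂ x∈t = All.lookup (Allᵛₚ.toList⁺ t⊆) x∈t

  onto : ∀ {x} → x ∈ xs → ∃[ y ] y ∈ fresh ++ toList t × y ≡ x
  onto {x} x∈ with x ∈? toList t
  ... | yes x∈t = x , ∈-++⁺ʳ fresh x∈t , refl
  ... | no x∉t  = x , ∈-++⁺ˡ (∈-filter⁺ _ x∈ x∉t) , refl

module _ {xs : List ℕ} (xs! : Listᵁ.Unique xs) where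

  arrangements : ∀ m → List (Vec ℕ m)
  arrangements m = filter distinct? (tuples xs m)

  arrangements-unique : ∀ m → Listᵁ.Unique (arrangements m)
  arrangements-unique m = Listᵁₚ.filter⁺ distinct? (tuples-unique xs! m)

  ∈-arrangements⁻ : ∀ {t : Vec ℕ m} → t ∈ arrangements m → All (_∈ xs) t × Unique t
  ∈-arrangements⁻ {m} t∈ with t∈ , t! ← ∈-filter⁻ distinct? {xs = tuples xs m} t∈ = ∈-tuples⁻ m t∈ , t!

  -- A new first letter avoids the m letters already placed, which is the recursion defining the
  -- falling factorial `_P′_`.
  length-arrangements : ∀ m → length (arrangements m) ≡ length xs P′ m
  length-arrangements zero    = refl
  length-arrangements (suc m) = begin
    length (arrangements (suc m)) ≡⟨ length-bijection
      (pairs-unique (arrangements-unique m) λ _ → Listᵁₚ.filter⁺ _ xs!)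
      (arrangements-unique (suc m)) (λ (t , x) → x ∷ t) into inj onto ⟨
    length ps ≡⟨ length-pairs-const (arrangements m) (λ t∈ → let t⊆ , t! = ∈-arrangements⁻ t∈ in length-fresh xs! t! t⊆) ⟩
    length (arrangements m) * (length xs ∸ m) ≡⟨ *-comm (length (arrangements m)) _ ⟩
    (length xs ∸ m) * length (arrangements m) ≡⟨ cong ((length xs ∸ m) *_) (length-arrangements m) ⟩
    (length xs ∸ m) * (length xs P′ m) ∎
    where
    open ≡-Reasoning
    ps = pairs (arrangements m) (λ t → filter (λ x → ¬? (x ∈? toList t)) xs)

    into : ∀ {p} → p ∈ ps → proj₂ p ∷ proj₁ p ∈ arrangements (suc m)
    into {t , x} p∈ with t∈ , x∈ ← ∈-pairs⁻ (arrangements m) p∈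
      with t⊆ , t! ← ∈-arrangements⁻ t∈ | x∈ , x∉ ← ∈-filter⁻ _ {xs = xs} x∈ =
      ∈-filter⁺ distinct? (∈-tuples (x∈ ∷ t⊆)) (Allᵛₚ.toList⁻ (Allₚ.¬Any⇒All¬ _ x∉) Vecᵁ.∷ t!)

    inj : ∀ {p q} → p ∈ ps → q ∈ ps → proj₂ p ∷ proj₁ p ≡ proj₂ q ∷ proj₁ q → p ≡ q
    inj _ _ refl = refl

    onto : ∀ {v} → v ∈ arrangements (suc m) → ∃[ p ] p ∈ ps × proj₂ p ∷ proj₁ p ≡ v
    onto {x ∷ t} v∈ with x∈ ∷ t⊆ , x∉ Vecᵁ.∷ t! ← ∈-arrangements⁻ v∈ =
      (t , x) , ∈-pairs⁺ (∈-filter⁺ distinct? (∈-tuples t⊆) t!)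
                         (∈-filter⁺ _ x∈ (Allₚ.All¬⇒¬Any (Allᵛₚ.toList⁺ x∉))) , refl

length-cartesianProductWith : ∀ (f : A → B → D) xs ys → length (cartesianProductWith f xs ys) ≡ length xs * length ys
length-cartesianProductWith f []       ys = refl
length-cartesianProductWith f (x ∷ xs) ys = trans (length-++ (List.map (f x) ys))
  (cong₂ _+_ (length-map (f x) ys) (length-cartesianProductWith f xs ys))

length-tuples : ∀ (xs : List A) k → length (tuples xs k) ≡ length xs ^ k
length-tuples xs zero    = refl
length-tuples xs (suc k) = trans (length-cartesianProductWith _∷_ xs (tuples xs k)) (cong (length xs *_) (length-tuples xs k))

distinctOn? : (ι : Vec (Fin n) m) → Decidable (λ (f : Vec ℕ n) → Unique (Vec.map (lookup f) ι))
distinctOn? ι f = distinct? (Vec.map (lookup f) ι)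

prefix : ∀ m r → Vec (Fin (m + r)) m
prefix m r = tabulate (_↑ˡ r)

prefix-unique : ∀ m r → Unique (prefix m r)
prefix-unique m r = Vecᵁₚ.tabulate⁺ (↑ˡ-injective r _ _)

map-lookup-prefix : ∀ {m r} (u : Vec A m) (v : Vec A r) → Vec.map (lookup (u Vec.++ v)) (prefix m r) ≡ u
map-lookup-prefix {r = r} u v = trans (sym (tabulate-∘ (lookup (u Vec.++ v)) (_↑ˡ r)))
  (trans (tabulate-cong (lookup-++ˡ u v)) (tabulate∘lookup u))

-- The first m letters form an arrangement, and the other r are free.
length-distinctOn-prefix : ∀ {xs : List ℕ} → Listᵁ.Unique xs → ∀ m r →
  length (filter (distinctOn? (prefix m r)) (tuples xs (m + r))) ≡ (length xs P′ m) * length xs ^ r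
length-distinctOn-prefix {xs} xs! m r = begin
  length (filter (distinctOn? (prefix m r)) (tuples xs (m + r))) ≡⟨ length-bijection
    (pairs-unique (arrangements-unique xs! m) λ _ → tuples-unique xs! r)
    (Listᵁₚ.filter⁺ (distinctOn? (prefix m r)) (tuples-unique xs! (m + r)))
    (λ (u , v) → u Vec.++ v) into inj onto ⟨
  length ps ≡⟨ length-pairs-const (arrangements xs! m) (λ _ → length-tuples xs r) ⟩
  length (arrangements xs! m) * length xs ^ r ≡⟨ cong (_* length xs ^ r) (length-arrangements xs! m) ⟩
  (length xs P′ m) * length xs ^ r ∎
  where
  open ≡-Reasoning
  ps = pairs (arrangements xs! m) (λ _ → tuples xs r)

  into : ∀ {p} → p ∈ ps → proj₁ p Vec.++ proj₂ p ∈ filter (distinctOn? (prefix m r)) (tuples xs (m + r))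
  into {u , v} p∈ with u∈ , v∈ ← ∈-pairs⁻ (arrangements xs! m) p∈ with u⊆ , u! ← ∈-arrangements⁻ xs! u∈ =
    ∈-filter⁺ (distinctOn? (prefix m r)) (∈-tuples (Allᵛₚ.++⁺ u⊆ (∈-tuples⁻ r v∈)))
      (subst Unique (sym (map-lookup-prefix u v)) u!)

  inj : ∀ {p q} → p ∈ ps → q ∈ ps → proj₁ p Vec.++ proj₂ p ≡ proj₁ q Vec.++ proj₂ q → p ≡ q
  inj {u , _} {w , _} _ _ eq with refl , refl ← ++-injective u w eq = refl

  onto : ∀ {f} → f ∈ filter (distinctOn? (prefix m r)) (tuples xs (m + r)) →
         ∃[ p ] p ∈ ps × proj₁ p Vec.++ proj₂ p ≡ f
  onto {f} f∈ with u , v , refl ← Vec.splitAt m f with f∈ , f! ← ∈-filter⁻ (distinctOn? (prefix m r)) {xs = tuples xs (m + r)} f∈ =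
    (u , v) , ∈-pairs⁺ (∈-filter⁺ distinct? (∈-tuples (Allᵛₚ.++ˡ⁻ u f⊆)) (subst Unique (map-lookup-prefix u v) f!))
                       (∈-tuples (Allᵛₚ.++ʳ⁻ u f⊆)) , refl
    where
    f⊆ = ∈-tuples⁻ (m + r) f∈

-- Exchanging cycles for distinct values at fixed positions.

map-injectiveᵛ : ∀ {f : A → B} → (∀ {x y} → f x ≡ f y → x ≡ y) → {v w : Vec A n} → Vec.map f v ≡ Vec.map f w → v ≡ w
map-injectiveᵛ inj {[]}    {[]}    _  = refl
map-injectiveᵛ inj {_ ∷ _} {_ ∷ _} eq with p , q ← Vec.∷-injective eq = cong₂ _∷_ (inj p) (map-injectiveᵛ inj q)

value : Fin n → ℕ
value = suc ∘ toℕ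

value-injective : {i j : Fin n} → value i ≡ value j → i ≡ j
value-injective = toℕ-injective ∘ suc-injective

fromValues : {v : Vec ℕ m} → All (InRange n) v → ∃[ js ] Vec.map {n = m} (value {n}) js ≡ v
fromValues []                                = [] , refl
fromValues {v = suc _ ∷ _} ((_ , v<n) ∷ rs) with is , eq ← fromValues rs =
  fromℕ< v<n ∷ is , cong₂ _∷_ (cong suc (toℕ-fromℕ< v<n)) eq

-- Exchangeability: if an m-cycle i₁,…,iₘ of π is moved onto the fixed positions ι, it
-- becomes a prime parking function with distinct values i₂,…,iₘ,i₁ there, from which
-- the cycle and π can be recovered.
sum-cycles : 1 ≤ N → {ι : Vec (Fin (suc N)) (suc m)} → Unique ι →
  sum (List.map (length ∘ cycles (suc m)) (primeParkingFunctions (suc N))) ≡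
  length (filter (distinctOn? ι) (primeParkingFunctions (suc N)))
sum-cycles {N} {m} 1≤N {ι} ι! = trans
  (sym (length-pairs L))
  (length-bijection
    (pairs-unique (primeParkingFunctions-unique (suc N)) λ {π} _ → cycles-unique (suc m) π)
    (Listᵁₚ.filter⁺ (distinctOn? ι) (primeParkingFunctions-unique (suc N)))
    move into inj onto)
  where
  L : List (Vec ℕ (suc N))
  L  = primeParkingFunctions (suc N)
  ps = pairs L (cycles (suc m))

  move : Vec ℕ (suc N) × Vec (Fin (suc N)) (suc m) → Vec ℕ (suc N)
  move (π , is) = permute (align ι is) π

  lookup-move : ∀ π {is} → Unique is → Vec.map (lookup (move (π , is))) ι ≡ Vec.map (lookup π) is
  lookup-move π {is} is! = trans (map-lookup-permute (align ι is) π ι) (cong (Vec.map (lookup π)) (map-align ι! is!))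

  ∈-ps⁻ : ∀ {π is} → (π , is) ∈ ps → PrimeCounts N π × Unique is × Vec.map (lookup (move (π , is))) ι ≡ Vec.map value (rotate is)
  ∈-ps⁻ {π} p∈ with π∈ , is∈ ← ∈-pairs⁻ L p∈ with is! , eq ← ∈-cycles⁻ π is∈ =
    ∈-prime⁻ 1≤N π∈ , is! , trans (lookup-move π is!) eq

  into : ∀ {p} → p ∈ ps → move p ∈ filter (distinctOn? ι) L
  into {π , is} p∈ with prime , is! , eq ← ∈-ps⁻ p∈ =
    ∈-filter⁺ (distinctOn? ι) (∈-prime⁺ 1≤N (counts-permute (align ι is) prime))
      (subst Unique (sym eq) (Vecᵁₚ.map⁺ value-injective (rotate-unique is!)))

  -- The permutation used by `move` depends on the cycle. The cycle is therefore recovered first,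
  -- from the values at ι; then both sides carry the same permutation, which cancels.
  same-cycle : ∀ {p q} → p ∈ ps → q ∈ ps → move p ≡ move q → proj₂ p ≡ proj₂ q
  same-cycle p∈ q∈ eq with _ , _ , p-eq ← ∈-ps⁻ p∈ | _ , _ , q-eq ← ∈-ps⁻ q∈ =
    rotate-injective (map-injectiveᵛ value-injective
      (trans (sym p-eq) (trans (cong (λ ρ → Vec.map (lookup ρ) ι) eq) q-eq)))

  inj : ∀ {p q} → p ∈ ps → q ∈ ps → move p ≡ move q → p ≡ q
  inj {_ , is} p∈ q∈ eq with refl ← same-cycle p∈ q∈ eq = cong (_, is) (permute-injective (align ι is) eq)

  onto : ∀ {ρ} → ρ ∈ filter (distinctOn? ι) L → ∃[ p ] p ∈ ps × move p ≡ ρ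
  onto {ρ} ρ∈ with ρ∈ , ρ! ← ∈-filter⁻ (distinctOn? ι) {xs = L} ρ∈
    with prime@(range , _) ← ∈-prime⁻ 1≤N ρ∈
    -- The values are at most N, hence below the length N + 1, and so name positions.
    with js , js-eq ← fromValues {n = suc N} (Allᵛₚ.map⁺ {f = lookup ρ} (Allᵛ.universal
           (λ i → let 1≤v , v≤N = Allᵛₚ.lookup⁺ range i in 1≤v , m≤n⇒m≤1+n v≤N) ι)) =
    (π , is) , ∈-pairs⁺ (∈-prime⁺ 1≤N (counts-permute (flip τ) prime)) (∈-cycles⁺ {π = π} (is! , eq)) , permute-flip τ ρ
    where
    -- The values at ι must be i₂,...,iₘ,i₁, so one rotation has to be undone.
    is = unrotate js
    τ  = align ι is
    π  = permute (flip τ) ρ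

    js! : Unique js
    js! = subst Unique (map-id js)
      (unique-map-reflect {f = value} {g = id} (λ _ _ → cong value) (subst Unique (sym js-eq) ρ!))

    is! : Unique is
    is! = iterate-preserves {P = Unique} rotate-unique m js!

    eq : Vec.map (lookup π) is ≡ Vec.map value (rotate is)
    eq = begin
      Vec.map (lookup π) is                     ≡⟨ lookup-move π is! ⟨
      Vec.map (lookup (permute τ π)) ι          ≡⟨ cong (λ v → Vec.map (lookup v) ι) (permute-flip τ ρ) ⟩
      Vec.map (lookup ρ) ι                      ≡⟨ js-eq ⟨
      Vec.map value js                          ≡⟨ cong (Vec.map value) (rotate-unrotate js) ⟨
      Vec.map value (rotate is)                 ∎
      where open ≡-Reasoning

-- From the counts to the expectation.

shift-injective : ∀ k d {v w} → InRange (k + d) v → InRange (k + d) w → shift k d v ≡ shift k d w → v ≡ w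
shift-injective k d r s eq = trans (sym (shift-inverse k d r)) (trans (cong (shift d k) eq) (shift-inverse k d s))

-- The translation invariance that `length-prime-*` asks for: translation is injective on the
-- alphabet.
shift-distinctOn : ∀ k d {f : Vec ℕ n} (ι : Vec (Fin n) m) → All (InRange (k + d)) f →
  Unique (Vec.map (lookup f) ι) → Unique (Vec.map (lookup (Vec.map (shift k d) f)) ι)
shift-distinctOn k d {f} ι range = unique-map-reflect λ i j eq →
  shift-injective k d (Allᵛₚ.lookup⁺ range i) (Allᵛₚ.lookup⁺ range j)
    (trans (sym (lookup-map i (shift k d) f)) (trans eq (lookup-map j (shift k d) f)))

-- The equation is an argument so that `prefix`, indexed by m + r, serves at length n without
-- transport.
distinct-positions : ∀ {n} m r → m + r ≡ n → ∃[ ι ] Unique {n = m} ι ×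
  (∀ {xs} → Listᵁ.Unique xs → length (filter (distinctOn? ι) (tuples xs n)) ≡ (length xs P′ m) * length xs ^ r)
distinct-positions m r refl = prefix m r , prefix-unique m r , λ xs! → length-distinctOn-prefix xs! m r

length-distinct-prime-* : 1 ≤ N → ∀ m r → m + r ≡ suc N → ∃[ ι ] Unique {n = m} ι ×
  length (filter (distinctOn? ι) (primeParkingFunctions (suc N))) * N ≡ (N P′ m) * N ^ r
length-distinct-prime-* {N} 1≤N m r eq with ι , ι! , len ← distinct-positions m r eq = ι , ι! , (begin
  length (filter (distinctOn? ι) (primeParkingFunctions (suc N))) * N
    ≡⟨ length-prime-* 1≤N (distinctOn? ι) (λ { k d refl → shift-distinctOn k d ι }) ⟩
  length (filter (distinctOn? ι) (tuples (values N) (suc N)))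
    ≡⟨ len (values-unique N) ⟩
  (length (values N) P′ m) * length (values N) ^ r
    ≡⟨ cong (λ l → (l P′ m) * l ^ r) (length-values N) ⟩
  (N P′ m) * N ^ r ∎)
  where open ≡-Reasoning

-- The case of no positions, where distinctness holds vacuously and the filter keeps everything.
length-prime : 1 ≤ N → length (primeParkingFunctions (suc N)) * N ≡ N ^ suc N
length-prime {N} 1≤N with [] , _ , eq ← length-distinct-prime-* 1≤N 0 (suc N) refl = begin
  length L * N                              ≡⟨ cong (λ l → length l * N) (filter-all (distinctOn? []) (All.universal (λ _ → Vecᵁ.[]) L)) ⟨
  length (filter (distinctOn? []) L) * N    ≡⟨ eq ⟩
  1 * N ^ suc N                             ≡⟨ *-identityˡ (N ^ suc N) ⟩
  N ^ suc N                                 ∎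
  where
  open ≡-Reasoning
  L = primeParkingFunctions (suc N)

nCk*k!≡nP′k : ∀ {n k} → k ≤ n → (n C k) * k ! ≡ n P′ k
nCk*k!≡nP′k {n} {k} k≤n = trans (cong (_* k !) (trans (nCk≡nPk/k! k≤n)
    (/-congˡ {{k !≢0}} (trans (nPk≡n!/[n∸k]! k≤n) (sym (nP′k≡n!/[n∸k]! k≤n))))))
  (m/n*n≡m {{k !≢0}} (k!∣nP′k k≤n))

-- Because `_/_` reduces to lowest terms, the argument passes through unnormalised rationals, where
-- equality is cross-multiplication.
/-cross : ∀ a b c d .{{_ : NonZero b}} .{{_ : NonZero d}} → a * d ≡ c * b → + a / b ≡ + c / d
/-cross a b@(suc _) c d@(suc _) eq = fromℚᵘ-cong {+ a ℚᵘ./ b} {+ c ℚᵘ./ d}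
  (ℚᵘ.*≡* (trans (sym (ℤ.pos-* a d)) (trans (cong +_ eq) (ℤ.pos-* c b))))

sum-map-* : ∀ (f : A → ℕ) c xs → sum (List.map f xs) * c ≡ sum (List.map (λ x → f x * c) xs)
sum-map-* f c []       = refl
sum-map-* f c (x ∷ xs) = trans (*-distribʳ-+ c (f x) (sum (List.map f xs))) (cong (λ t → f x * c + t) (sum-map-* f c xs))

-- Both sides are compared after multiplication by `suc m * N`: the factor `suc m` turns cycles into
-- the tuples representing them, and N turns prime parking functions into words.
sum-cycleCount : ∀ {m} → suc m ≤ N →
  sum (List.map (cycleCount (suc m)) (primeParkingFunctions (suc N))) * N ^ suc m ≡
  (m ! * (N C suc m)) * length (primeParkingFunctions (suc N))
sum-cycleCount {N} {m} m<N with r , m+r≡N ← m≤n⇒∃[o]m+o≡n (<⇒≤ m<N)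
  with ι , ι! , eq ← length-distinct-prime-* (≤-trans (s≤s z≤n) m<N) (suc m) r (cong suc m+r≡N) =
  *-cancelʳ-≡ _ _ (suc m * N) {{m*n≢0 (suc m) N}} (begin
    S * N ^ suc m * (suc m * N)
      ≡⟨ solve 4 (λ s p m n → s :* p :* (m :* n) := (s :* m) :* n :* p) refl S (N ^ suc m) (suc m) N ⟩
    S * suc m * N * N ^ suc m
      ≡⟨ cong (λ s → s * N * N ^ suc m) S-eq ⟩
    M * N * N ^ suc m
      ≡⟨ cong (_* N ^ suc m) eq ⟩
    (N P′ suc m) * N ^ r * N ^ suc m
      ≡⟨ *-assoc (N P′ suc m) (N ^ r) (N ^ suc m) ⟩
    (N P′ suc m) * (N ^ r * N ^ suc m)
      -- The r free letters and the `suc m` prescribed ones make up the whole word of length N + 1.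
      ≡⟨ cong ((N P′ suc m) *_) (trans (sym (^-distribˡ-+-* N r (suc m)))
           (cong (N ^_) (trans (+-suc r m) (cong suc (trans (+-comm r m) m+r≡N))))) ⟩
    (N P′ suc m) * N ^ suc N
      ≡⟨ cong₂ _*_ (nCk*k!≡nP′k m<N) (length-prime 1≤N) ⟨
    (N C suc m) * (suc m) ! * (length L * N)
      ≡⟨ solve 5 (λ c m f l n → c :* (m :* f) :* (l :* n) := (f :* c) :* l :* (m :* n)) refl (N C suc m) (suc m) (m !) (length L) N ⟩
    (m ! * (N C suc m)) * length L * (suc m * N) ∎)
  where
  open ≡-Reasoning
  open +-*-Solver
  1≤N : 1 ≤ N
  1≤N = ≤-trans (s≤s z≤n) m<N
  instance _ = >-nonZero 1≤N
  L = primeParkingFunctions (suc N)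
  S = sum (List.map (cycleCount (suc m)) L)
  M = length (filter (distinctOn? ι) L)

  S-eq : S * suc m ≡ M
  S-eq = trans (sum-map-* (cycleCount (suc m)) (suc m) L)
    (trans (cong sum (map-cong (cycleCount-* m) L)) (sum-cycles 1≤N ι!))

theorem3p4 : (m n : ℕ) (1≤m : 1 ≤ m) (m≤n-1 : m ≤ n ∸ 1) →
    𝔼 n (cycleCount m) ≡
    _/_ (+ ((m ∸ 1) ! * ((n ∸ 1) C m))) ((n ∸ 1) ^ m)
    {{m^n≢0 (n ∸ 1) m {{>-nonZero (≤-trans 1≤m m≤n-1)}}}}
theorem3p4 (suc m) (suc N) 1≤m m≤N =
  /-cross (sum (List.map (cycleCount (suc m)) (primeParkingFunctions (suc N)))) _ (m ! * (N C suc m)) (N ^ suc m)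
    {{primeParkingFunctions-nonEmpty (suc N)}} {{m^n≢0 N (suc m) {{>-nonZero (≤-trans 1≤m m≤N)}}}}
    (sum-cycleCount m≤N)
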